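{- Let $G$ be a 2-connected, linear-convex supergrid graph. Then $G$ is locally connected, i.e., for every vertex $u$ of $G$, the subgraph of $G$ induced by the neighbourhood $N(u)$ of $u$ is connected.
   Context: The two-dimensional supergrid $S^\infty$ is the infinite graph whose vertex set is $\mathbb{Z}^2$, in which two distinct vertices $(a,b)$ and $(c,d)$ are adjacent if and only if $|a-c|\le 1$ and $|b-d|\le 1$. A supergrid graph is a finite vertex-induced subgraph of $S^\infty$. A supergrid graph $G$ is linear-convex if for every line $l$ in the plane that contains an edge of $S^\infty$ (every horizontal, vertical, slope $+1$ or slope $-1$ line through integer points), the intersection of $l$ with $G$ is either empty, a single vertex, or a line segment forming a path of $G$; equivalently, the vertices of $G$ on $l$ form a (possibly empty) set of consecutive lattice points of $l$. A graph is 2-connected if there are two internally vertex-disjoint paths between every pair of its vertices (with the standard convention that it has at least three vertices). $N(u)$ denotes the set of vertices adjacent to $u$. -}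

module Defs where

open import Data.Integer using (ℤ; +_; _+_; _-_; -[1+_]; ∣_∣; _*_)
open import Data.Nat as ℕ using (ℕ; _≤_)
open import Data.Product using (_×_; _,_; ∃; ∃-syntax; Σ)
open import Data.List using (List; []; _∷_; _++_)
open import Data.List.Membership.Propositional using (_∈_; _∉_)
open import Data.List.Relation.Unary.All using (All)
open import Data.List.Relation.Unary.Unique.Propositional using (Unique)
open import Relation.Binary.PropositionalEquality using (_≡_; _≢_)

-- Vertices of the infinite supergrid S^∞.
V : Set
V = ℤ × ℤ

-- Adjacency in S^∞: distinct, and both coordinates differ by at most 1.
Adj : V → V → Set
Adj (a , b) (c , d) = ((a , b) ≢ (c , d)) × (∣ a - c ∣ ≤ 1) × (∣ b - d ∣ ≤ 1)

-- A supergrid graph: the finite vertex-induced subgraph of S^∞ on the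
-- vertex set given by a finite list (duplicates are irrelevant).
SupergridGraph : Set
SupergridGraph = List V

-- The four directions of lines containing an edge of S^∞:
-- horizontal, vertical, slope +1, slope -1.
data Dir : Set where
  horiz vert diag antidiag : Dir

vec : Dir → V
vec horiz    = (+ 1 , + 0)
vec vert     = (+ 0 , + 1)
vec diag     = (+ 1 , + 1)
vec antidiag = (+ 1 , -[1+ 0 ])

-- p + k·d
shift : V → Dir → ℕ → V
shift (x , y) d k with vec d
... | (dx , dy) = (x + (+ k) * dx , y + (+ k) * dy)

-- Linear-convex: on every line l of one of the four directions, the
-- vertices of G on l are consecutive lattice points of l.  Equivalently:
-- whenever p and p + k·d both lie in G, so does every p + j·d, j ≤ k.
LinearConvex : SupergridGraph → Set
LinearConvex G = ∀ (p : V) (d : Dir) (k j : ℕ) →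
  p ∈ G → shift p d k ∈ G → j ≤ k → shift p d j ∈ G

-- Consecutive vertices of a list are adjacent.
data Chain : List V → Set where
  nil  : Chain []
  one  : ∀ {x} → Chain (x ∷ [])
  cons : ∀ {x y zs} → Adj x y → Chain (y ∷ zs) → Chain (x ∷ y ∷ zs)

-- A path of G from x to y with internal vertex list is:
-- the vertex sequence x ∷ is ++ [y] lies in G, has no repeated vertex,
-- and consecutive vertices are adjacent.
IsPath : SupergridGraph → V → V → List V → Set
IsPath G x y is =
  let vs = x ∷ (is ++ (y ∷ [])) in
  All (_∈ G) vs × Unique vs × Chain vs

-- 2-connected: at least three vertices, and between every pair of
-- distinct vertices there are two (distinct) internally vertex-disjoint paths.
TwoConnected : SupergridGraph → Set
TwoConnected G =
  (∃[ a ] ∃[ b ] ∃[ c ] (a ∈ G × b ∈ G × c ∈ G × a ≢ b × a ≢ c × b ≢ c)) ×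
  (∀ x y → x ∈ G → y ∈ G → x ≢ y →
     ∃[ is ] ∃[ js ] (IsPath G x y is × IsPath G x y js × is ≢ js ×
                      (∀ w → w ∈ is → w ∉ js)))

-- Walks inside the vertex set described by P (induced subgraph on P).
data Walk (P : V → Set) : V → V → Set where
  here : ∀ {x} → Walk P x x
  step : ∀ {x y z} → P y → Adj x y → Walk P y z → Walk P x z

-- The neighbourhood N(u) of u in G.
InNbhd : SupergridGraph → V → V → Set
InNbhd G u w = (w ∈ G) × Adj u w

-- The subgraph induced by the vertex set P is connected.
InducedConnected : (V → Set) → Set
InducedConnected P = ∀ x y → P x → P y → Walk P x y

-- G is locally connected: for every vertex u, G[N(u)] is connected.
LocallyConnected : SupergridGraph → Set
LocallyConnected G = ∀ u → u ∈ G → InducedConnected (InNbhd G u)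

-- Linear convexity makes the axis rays from a vertex u rigid: if G contains a vertex other
-- than u on one of the four axis rays from u, it contains u's neighbour on that ray.  Since
-- G − u is connected and an edge moves each coordinate by at most one, a walk in G − u that
-- leaves an open quadrant or half-plane around u must step onto such a ray.  Hence a corner
-- neighbour of u (reached from u by a detour avoiding the direct edge) always has an axial
-- neighbour of u beside it, and two opposite axial neighbours are always joined through a
-- perpendicular one; as perpendicular axial neighbours are adjacent, N(u) is connected.
module Submission where

open import Defs
open import Data.Integer as ℤ
  using (ℤ; +_; +[1+_]; -[1+_]; _+_; _-_; -_; _*_; ∣_∣; 0ℤ; sign; _◃_)
import Data.Integer.Properties as ℤ
open import Data.Integer.Tactic.RingSolver using (solve-∀)
open import Data.Nat as ℕ using (zero; suc; _≤_; z≤n; s≤s)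
import Data.Nat.Properties as ℕ
open import Data.Sign as Sign using (Sign; opposite)
open import Data.Product using (_×_; _,_; proj₁; proj₂; ∃-syntax)
open import Data.Product.Properties using (≡-dec)
open import Data.Sum using (_⊎_; inj₁; inj₂)
open import Data.Empty using (⊥; ⊥-elim)
open import Data.Unit using (⊤)
open import Data.List using ([]; _∷_; _++_)
open import Data.List.Membership.Propositional using (_∈_; _∉_)
open import Data.List.Membership.DecPropositional (≡-dec ℤ._≟_ ℤ._≟_) using (_∈?_)
open import Data.List.Relation.Unary.All as All using (All; []; _∷_)
open import Data.List.Relation.Unary.All.Properties using (¬Any⇒All¬; ++⁺; ++⁻ʳ)
open import Data.List.Relation.Unary.AllPairs using (_∷_)
open import Relation.Nullary using (¬_; Dec; yes; no; ¬?)
open import Relation.Nullary.Decidable using (True; toWitness; _×-dec_)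
open import Relation.Binary.PropositionalEquality

private variable
  s t : Sign
  i j : ℤ
  p q w x y z : V

Signed : Sign → ℤ → Set
Signed Sign.+ +[1+ _ ] = ⊤
Signed Sign.- -[1+ _ ] = ⊤
Signed _      _        = ⊥

signed-◃1 : ∀ s → Signed s (s ◃ 1)
signed-◃1 Sign.+ = _
signed-◃1 Sign.- = _

signed-◃1⇒≡ : Signed s (t ◃ 1) → s ≡ t
signed-◃1⇒≡ {Sign.+} {Sign.+} _ = refl
signed-◃1⇒≡ {Sign.-} {Sign.-} _ = refl

¬signed-opposite : ∀ s → ¬ Signed s (opposite s ◃ 1)
¬signed-opposite Sign.+ ()
¬signed-opposite Sign.- ()

¬signed-0 : ¬ Signed s 0ℤ
¬signed-0 {Sign.+} ()
¬signed-0 {Sign.-} ()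

signed-sign : i ≢ 0ℤ → Signed (sign i) i
signed-sign {+[1+ _ ]} _ = _
signed-sign {+ zero}   i≢0 = i≢0 refl
signed-sign { -[1+ _ ]} _ = _

signed-step : ∣ i - j ∣ ≤ 1 → Signed s i → j ≡ 0ℤ ⊎ Signed s j
signed-step {+[1+ _ ]} {+[1+ _ ]} {Sign.+} _ _ = inj₂ _
signed-step {+[1+ _ ]} {+ zero}   {Sign.+} _ _ = inj₁ refl
signed-step {+[1+ m ]} { -[1+ n ]} {Sign.+} (s≤s m+1+n≤0) _
  with () ← subst (_≤ 0) (ℕ.+-suc m n) m+1+n≤0
signed-step { -[1+ _ ]} { -[1+ _ ]} {Sign.-} _ _ = inj₂ _
signed-step { -[1+ _ ]} {+ zero}    {Sign.-} _ _ = inj₁ refl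
signed-step { -[1+ _ ]} {+[1+ _ ]}  {Sign.-} (s≤s ()) _

unit-interval : ∣ 0ℤ - i ∣ ≤ 1 → i ≡ 0ℤ ⊎ ∃[ s ] i ≡ s ◃ 1
unit-interval {+ zero}          _        = inj₁ refl
unit-interval {+[1+ zero ]}     _        = inj₂ (Sign.+ , refl)
unit-interval {+[1+ suc _ ]}    (s≤s ())
unit-interval { -[1+ zero ]}    _        = inj₂ (Sign.- , refl)
unit-interval { -[1+ suc _ ]}   (s≤s ())

_⊕_ : V → V → V
(a , b) ⊕ (i , j) = (a + i , b + j)

_⊖_ : V → V → V
(c , d) ⊖ (a , b) = (c - a , d - b)

scale : ℤ → V → V
scale k (i , j) = (k * i , k * j)

origin : V
origin = (0ℤ , 0ℤ)

⊕-identityʳ : ∀ p → p ⊕ origin ≡ p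
⊕-identityʳ (a , b) = cong₂ _,_ (ℤ.+-identityʳ a) (ℤ.+-identityʳ b)

p⊕[q⊖p]≡q : ∀ p q → p ⊕ (q ⊖ p) ≡ q
p⊕[q⊖p]≡q (a , b) (c , d) = cong₂ _,_ (lemma a c) (lemma b d)
  where
  lemma : ∀ a c → a + (c - a) ≡ c
  lemma = solve-∀

[p⊕o]⊖p≡o : ∀ p o → (p ⊕ o) ⊖ p ≡ o
[p⊕o]⊖p≡o (a , b) (i , j) = cong₂ _,_ (lemma a i) (lemma b j)
  where
  lemma : ∀ a i → (a + i) - a ≡ i
  lemma = solve-∀

⊕-cancelˡ : ∀ p {o o′} → p ⊕ o ≡ p ⊕ o′ → o ≡ o′
⊕-cancelˡ p {o} {o′} eq = begin
  o               ≡⟨ [p⊕o]⊖p≡o p o ⟨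
  (p ⊕ o) ⊖ p     ≡⟨ cong (_⊖ p) eq ⟩
  (p ⊕ o′) ⊖ p    ≡⟨ [p⊕o]⊖p≡o p o′ ⟩
  o′              ∎
  where open ≡-Reasoning

adj? : ∀ p q → Dec (Adj p q)
adj? (a , b) (c , d) =
  ¬? (≡-dec ℤ._≟_ ℤ._≟_ (a , b) (c , d)) ×-dec (∣ a - c ∣ ℕ.≤? 1) ×-dec (∣ b - d ∣ ℕ.≤? 1)

adjacent! : ∀ {p q} {_ : True (adj? p q)} → Adj p q
adjacent! {p} {q} {witness} = toWitness {a? = adj? p q} witness

Adj-sym : Adj p q → Adj q p
Adj-sym {a , b} {c , d} (p≢q , ∣a-c∣≤1 , ∣b-d∣≤1) =
  (λ q≡p → p≢q (sym q≡p)) ,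
  subst (_≤ 1) (ℤ.∣i-j∣≡∣j-i∣ a c) ∣a-c∣≤1 ,
  subst (_≤ 1) (ℤ.∣i-j∣≡∣j-i∣ b d) ∣b-d∣≤1

translate-diff : ∀ a i i′ → (a + i) - (a + i′) ≡ i - i′
translate-diff = solve-∀

Adj-⊕⁺ : ∀ p {o o′} → Adj o o′ → Adj (p ⊕ o) (p ⊕ o′)
Adj-⊕⁺ (a , b) {i , j} {i′ , j′} (o≢o′ , h₁ , h₂) =
  (λ eq → o≢o′ (⊕-cancelˡ (a , b) eq)) ,
  subst (_≤ 1) (cong ∣_∣ (sym (translate-diff a i i′))) h₁ ,
  subst (_≤ 1) (cong ∣_∣ (sym (translate-diff b j j′))) h₂

Adj-⊕⁻ : ∀ p {o o′} → Adj (p ⊕ o) (p ⊕ o′) → Adj o o′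
Adj-⊕⁻ (a , b) {i , j} {i′ , j′} (≢ , h₁ , h₂) =
  (λ eq → ≢ (cong ((a , b) ⊕_) eq)) ,
  subst (_≤ 1) (cong ∣_∣ (translate-diff a i i′)) h₁ ,
  subst (_≤ 1) (cong ∣_∣ (translate-diff b j j′)) h₂

Adj-⊖ : ∀ r → Adj p q → Adj (p ⊖ r) (q ⊖ r)
Adj-⊖ {p} {q} r adj = Adj-⊕⁻ r (subst₂ Adj (sym (p⊕[q⊖p]≡q r p)) (sym (p⊕[q⊖p]≡q r q)) adj)

shift≡⊕scale : ∀ p d k → shift p d k ≡ p ⊕ scale (+ k) (vec d)
shift≡⊕scale (a , b) d k with vec d
... | _ = refl

ray : ∀ {G p i} d → LinearConvex G → p ∈ G → p ⊕ scale i (vec d) ∈ G → Signed s i →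
      p ⊕ scale (s ◃ 1) (vec d) ∈ G
ray {Sign.+} {G} {p} {+[1+ n ]} d convex p∈G far∈G _ =
  subst (_∈ G) (shift≡⊕scale p d 1)
    (convex p d (suc n) 1 p∈G (subst (_∈ G) (sym (shift≡⊕scale p d (suc n))) far∈G) (s≤s z≤n))
ray {Sign.-} {G} {p} { -[1+ n ]} d convex p∈G far∈G _ =
  subst (_∈ G) (trans (shift≡⊕scale far d n) (back-to-neighbour p (vec d)))
    (convex far d (suc n) n far∈G
      (subst (_∈ G) (sym (trans (shift≡⊕scale far d (suc n)) (back-to-p p (vec d)))) p∈G)
      (ℕ.n≤1+n n))
  where
  far : V
  far = p ⊕ scale -[1+ n ] (vec d)
  back-to-p : ∀ p v → (p ⊕ scale (- + suc n) v) ⊕ scale (+ suc n) v ≡ p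
  back-to-p (a , b) (c , e) = cong₂ _,_ (lemma a (+ suc n) c) (lemma b (+ suc n) e)
    where
    lemma : ∀ a k c → (a + (- k) * c) + k * c ≡ a
    lemma = solve-∀
  back-to-neighbour : ∀ p v → (p ⊕ scale (- (+ 1 + + n)) v) ⊕ scale (+ n) v ≡ p ⊕ scale (- + 1) v
  back-to-neighbour (a , b) (c , e) = cong₂ _,_ (lemma a (+ n) c) (lemma b (+ n) e)
    where
    lemma : ∀ a k c → (a + (- (+ 1 + k)) * c) + k * c ≡ a + (- + 1) * c
    lemma = solve-∀

_++ʷ_ : ∀ {P} → Walk P x y → Walk P y z → Walk P x z
here             ++ʷ w′ = w′
step py adj w    ++ʷ w′ = step py adj (w ++ʷ w′)

reverseʷ : ∀ {P} → P x → Walk P x y → Walk P y x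
reverseʷ px here           = here
reverseʷ px (step py adj w) = reverseʷ py w ++ʷ step px (Adj-sym adj) here

StepClosed : (V → Set) → (V → Set) → Set
StepClosed P R = ∀ {p q} → P q → Adj p q → R p → R q

walk-preserves : ∀ {P R} → StepClosed P R → Walk P x y → R x → R y
walk-preserves closed here             rx = rx
walk-preserves closed (step py adj w) rx = walk-preserves closed w (closed py adj rx)

chain⇒walk : ∀ {P} is → Chain (x ∷ is ++ y ∷ []) → All P (is ++ y ∷ []) → Walk P x y
chain⇒walk []       (cons adj one) (py ∷ [])  = step py adj here
chain⇒walk (_ ∷ is) (cons adj ch)  (pi ∷ ps)  = step pi adj (chain⇒walk is ch ps)

_∖_ : SupergridGraph → V → V → Set
(G ∖ u) v = v ∈ G × u ≢ v

all-≢-++ : ∀ {u} ks → u ∉ ks → u ≢ y → All (u ≢_) (ks ++ y ∷ [])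
all-≢-++ ks u∉ks u≢y = ++⁺ (¬Any⇒All¬ ks u∉ks) (u≢y ∷ [])

-- Uniqueness of the vertices of the path makes its remainder avoid x and w differ from y.
path-detour : ∀ {G w} is → IsPath G x y (w ∷ is) →
              w ∈ G × Adj x w × w ≢ y × Walk (G ∖ x) w y
path-detour is (_ ∷ w∈G ∷ is∈G , (x≢ ∷ (w≢ ∷ _)) , cons adj chain) =
  w∈G , adj , All.head (++⁻ʳ is w≢) , chain⇒walk is chain (All.zip (is∈G , All.tail x≢))

module _ {G : SupergridGraph} (two-connected : TwoConnected G) where

  avoiding-walk : ∀ {u} → x ∈ G → y ∈ G → x ≢ y → u ≢ x → u ≢ y → Walk (G ∖ u) x y
  avoiding-walk {x} {y} {u} x∈G y∈G x≢y u≢x u≢y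
    with proj₂ two-connected x y x∈G y∈G x≢y
  ... | is , js , (_ ∷ is∈G , _ , is-chain) , (_ ∷ js∈G , _ , js-chain) , _ , disjoint
    with u ∈? is
  ... | yes u∈is = chain⇒walk js js-chain (All.zip (js∈G , all-≢-++ js (disjoint u u∈is) u≢y))
  ... | no  u∉is = chain⇒walk is is-chain (All.zip (is∈G , all-≢-++ is u∉is u≢y))

  detour : x ∈ G → y ∈ G → x ≢ y → ∃[ w ] (w ∈ G × Adj x w × w ≢ y × Walk (G ∖ x) w y)
  detour {x} {y} x∈G y∈G x≢y with proj₂ two-connected x y x∈G y∈G x≢y
  ... | w ∷ is , _      , path , _ , _      , _ = w , path-detour is path
  ... | []     , w ∷ js , _ , path , _      , _ = w , path-detour js path
  ... | []     , []     , _ , _    , []≢[] , _ = ⊥-elim ([]≢[] refl)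

data Axis : Set where
  horizontal vertical : Axis

private variable
  α : Axis

perp : Axis → Axis
perp horizontal = vertical
perp vertical   = horizontal

direction : Axis → Dir
direction horizontal = horiz
direction vertical   = vert

component : Axis → V → ℤ
component horizontal = proj₁
component vertical   = proj₂

axial : Axis → ℤ → V
axial horizontal i = (i , 0ℤ)
axial vertical   i = (0ℤ , i)

scale-direction : ∀ α i → scale i (vec (direction α)) ≡ axial α i
scale-direction horizontal i = cong₂ _,_ (ℤ.*-identityʳ i) (ℤ.*-zeroʳ i)
scale-direction vertical   i = cong₂ _,_ (ℤ.*-zeroʳ i) (ℤ.*-identityʳ i)

component-axial : ∀ α i → component α (axial α i) ≡ i
component-axial horizontal _ = refl
component-axial vertical   _ = refl

axial-zero : ∀ α → axial α 0ℤ ≡ origin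
axial-zero horizontal = refl
axial-zero vertical   = refl

on-perp-axis : ∀ α {o} → component α o ≡ 0ℤ → o ≡ axial (perp α) (component (perp α) o)
on-perp-axis horizontal refl = refl
on-perp-axis vertical   refl = refl

component-adj : ∀ α {o o′} → Adj o o′ → ∣ component α o - component α o′ ∣ ≤ 1
component-adj horizontal (_ , h , _) = h
component-adj vertical   (_ , _ , h) = h

data Neighbour : Set where
  axis   : Axis → Sign → Neighbour
  corner : Sign → Sign → Neighbour

offset : Neighbour → V
offset (axis α s)   = axial α (s ◃ 1)
offset (corner s t) = (s ◃ 1 , t ◃ 1)

origin-adj-offset : ∀ n → Adj origin (offset n)
origin-adj-offset (axis horizontal Sign.+) = adjacent!
origin-adj-offset (axis horizontal Sign.-) = adjacent!
origin-adj-offset (axis vertical   Sign.+) = adjacent!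
origin-adj-offset (axis vertical   Sign.-) = adjacent!
origin-adj-offset (corner Sign.+ Sign.+)   = adjacent!
origin-adj-offset (corner Sign.+ Sign.-)   = adjacent!
origin-adj-offset (corner Sign.- Sign.+)   = adjacent!
origin-adj-offset (corner Sign.- Sign.-)   = adjacent!

origin-adj⇒offset : ∀ {o} → Adj origin o → ∃[ n ] o ≡ offset n
origin-adj⇒offset {i , j} (o≢0 , h₁ , h₂) with unit-interval {i} h₁ | unit-interval {j} h₂
... | inj₁ refl       | inj₁ refl       = ⊥-elim (o≢0 refl)
... | inj₂ (s , refl) | inj₁ refl       = axis horizontal s , refl
... | inj₁ refl       | inj₂ (t , refl) = axis vertical t , refl
... | inj₂ (s , refl) | inj₂ (t , refl) = corner s t , refl

corner-adj-axes : ∀ s t → Adj (offset (corner s t)) (offset (axis horizontal s)) ×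
                          Adj (offset (corner s t)) (offset (axis vertical t))
corner-adj-axes Sign.+ Sign.+ = adjacent! , adjacent!
corner-adj-axes Sign.+ Sign.- = adjacent! , adjacent!
corner-adj-axes Sign.- Sign.+ = adjacent! , adjacent!
corner-adj-axes Sign.- Sign.- = adjacent! , adjacent!

axis-adj-perp : ∀ α s t → Adj (offset (axis α s)) (offset (axis (perp α) t))
axis-adj-perp horizontal Sign.+ Sign.+ = adjacent!
axis-adj-perp horizontal Sign.+ Sign.- = adjacent!
axis-adj-perp horizontal Sign.- Sign.+ = adjacent!
axis-adj-perp horizontal Sign.- Sign.- = adjacent!
axis-adj-perp vertical   Sign.+ Sign.+ = adjacent!
axis-adj-perp vertical   Sign.+ Sign.- = adjacent!
axis-adj-perp vertical   Sign.- Sign.+ = adjacent!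
axis-adj-perp vertical   Sign.- Sign.- = adjacent!

opposite-offsets-≢ : ∀ α s → offset (axis α s) ≢ offset (axis α (opposite s))
opposite-offsets-≢ horizontal Sign.+ ()
opposite-offsets-≢ horizontal Sign.- ()
opposite-offsets-≢ vertical   Sign.+ ()
opposite-offsets-≢ vertical   Sign.- ()

signed-offset⇒corner : ∀ n → Signed s (component horizontal (offset n)) →
                       Signed t (component vertical (offset n)) → n ≡ corner s t
signed-offset⇒corner (axis horizontal _) _  ht = ⊥-elim (¬signed-0 ht)
signed-offset⇒corner (axis vertical _)   hs _  = ⊥-elim (¬signed-0 hs)
signed-offset⇒corner (corner _ _)        hs ht = sym (cong₂ corner (signed-◃1⇒≡ hs) (signed-◃1⇒≡ ht))

module Neighbourhood (G : SupergridGraph) (two-connected : TwoConnected G)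
                     (convex : LinearConvex G) (u : V) (u∈G : u ∈ G) where

  coord : Axis → V → ℤ
  coord α q = component α (q ⊖ u)

  Present : Neighbour → Set
  Present n = u ⊕ offset n ∈ G

  present? : ∀ n → Dec (Present n)
  present? n = u ⊕ offset n ∈? G

  Nbhd : V → Set
  Nbhd = InNbhd G u

  u~neighbour : ∀ n → Adj u (u ⊕ offset n)
  u~neighbour n = subst (λ v → Adj v (u ⊕ offset n)) (⊕-identityʳ u) (Adj-⊕⁺ u (origin-adj-offset n))

  neighbour-view : Nbhd q → ∃[ n ] (Present n × q ≡ u ⊕ offset n)
  neighbour-view {q} (q∈G , u~q) = from-offset (origin-adj⇒offset origin~q⊖u)
    where
    origin~q⊖u : Adj origin (q ⊖ u)
    origin~q⊖u = Adj-⊕⁻ u (subst₂ Adj (sym (⊕-identityʳ u)) (sym (p⊕[q⊖p]≡q u q)) u~q)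

    from-offset : ∃[ n ] q ⊖ u ≡ offset n → ∃[ n ] (Present n × q ≡ u ⊕ offset n)
    from-offset (n , q⊖u≡n) = n , subst (_∈ G) q≡ q∈G , q≡
      where
      q≡ : q ≡ u ⊕ offset n
      q≡ = trans (sym (p⊕[q⊖p]≡q u q)) (cong (u ⊕_) q⊖u≡n)

  coord-offset : ∀ α n → coord α (u ⊕ offset n) ≡ component α (offset n)
  coord-offset α n = cong (component α) ([p⊕o]⊖p≡o u (offset n))

  coord-step : ∀ α → Adj p q → Signed s (coord α p) → coord α q ≡ 0ℤ ⊎ Signed s (coord α q)
  coord-step α adj = signed-step (component-adj α (Adj-⊖ u adj))

  coord-zero⇒on-perp-axis : ∀ α → coord α q ≡ 0ℤ → q ≡ u ⊕ axial (perp α) (coord (perp α) q)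
  coord-zero⇒on-perp-axis {q} α c≡0 = trans (sym (p⊕[q⊖p]≡q u q)) (cong (u ⊕_) (on-perp-axis α c≡0))

  at-centre : ∀ α → coord α q ≡ 0ℤ → coord (perp α) q ≡ 0ℤ → q ≡ u
  at-centre {q} α c≡0 c⊥≡0 = begin
    q                                       ≡⟨ coord-zero⇒on-perp-axis α c≡0 ⟩
    u ⊕ axial (perp α) (coord (perp α) q)   ≡⟨ cong (λ i → u ⊕ axial (perp α) i) c⊥≡0 ⟩
    u ⊕ axial (perp α) 0ℤ                   ≡⟨ cong (u ⊕_) (axial-zero (perp α)) ⟩
    u ⊕ origin                              ≡⟨ ⊕-identityʳ u ⟩
    u                                       ∎
    where open ≡-Reasoning

  axis-ray : ∀ α → q ∈ G → coord α q ≡ 0ℤ → Signed s (coord (perp α) q) → Present (axis (perp α) s)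
  axis-ray {q} {s} α q∈G c≡0 signed =
    subst (_∈ G) (cong (u ⊕_) (scale-direction (perp α) (s ◃ 1)))
      (ray (direction (perp α)) convex u∈G (subst (_∈ G) q≡ q∈G) signed)
    where
    q≡ : q ≡ u ⊕ scale (coord (perp α) q) (vec (direction (perp α)))
    q≡ = trans (coord-zero⇒on-perp-axis α c≡0) (cong (u ⊕_) (sym (scale-direction (perp α) _)))

  signed-neighbour⇒corner : Nbhd w → Signed s (coord horizontal w) → Signed t (coord vertical w) →
                            w ≡ u ⊕ offset (corner s t)
  signed-neighbour⇒corner {w} {s} {t} nw sh sv = from-view (neighbour-view nw)
    where
    from-view : ∃[ n ] (Present n × w ≡ u ⊕ offset n) → w ≡ u ⊕ offset (corner s t)
    from-view (n , _ , w≡) = trans w≡ (cong (λ m → u ⊕ offset m)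
      (signed-offset⇒corner n (subst (Signed s) (coord-at horizontal) sh)
                              (subst (Signed t) (coord-at vertical) sv)))
      where
      coord-at : ∀ α → coord α w ≡ component α (offset n)
      coord-at α = trans (cong (coord α) w≡) (coord-offset α n)

  -- Leaving the open quadrant of c through G − u lands on an axis ray of u, which linear
  -- convexity pulls back to an axial neighbour next to c.
  corner-isolated : Present (corner s t) → ¬ Present (axis horizontal s) → ¬ Present (axis vertical t) → ⊥
  corner-isolated {s} {t} c∈G h∉G v∉G =
    isolated (detour two-connected u∈G c∈G (proj₁ (u~neighbour (corner s t))))
    where
    c : V
    c = u ⊕ offset (corner s t)

    Inside : V → Set
    Inside q = Signed s (coord horizontal q) × Signed t (coord vertical q)

    closed : StepClosed (G ∖ u) Inside
    closed {q = q} (q∈G , u≢q) adj (sh , sv)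
      with coord-step horizontal adj sh | coord-step vertical adj sv
    ... | inj₂ sh′ | inj₂ sv′ = sh′ , sv′
    ... | inj₁ h≡0 | inj₁ v≡0 = ⊥-elim (u≢q (sym (at-centre horizontal h≡0 v≡0)))
    ... | inj₁ h≡0 | inj₂ sv′ = ⊥-elim (v∉G (axis-ray horizontal q∈G h≡0 sv′))
    ... | inj₂ sh′ | inj₁ v≡0 = ⊥-elim (h∉G (axis-ray vertical q∈G v≡0 sh′))

    c-inside : Inside c
    c-inside = subst (Signed s) (sym (coord-offset horizontal (corner s t))) (signed-◃1 s) ,
               subst (Signed t) (sym (coord-offset vertical (corner s t))) (signed-◃1 t)

    isolated : ∃[ w ] (w ∈ G × Adj u w × w ≢ c × Walk (G ∖ u) w c) → ⊥
    isolated (w , w∈G , u~w , w≢c , walk) =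
      let sh , sv = walk-preserves closed (reverseʷ (w∈G , proj₁ u~w) walk) c-inside
      in w≢c (signed-neighbour⇒corner (w∈G , u~w) sh sv)

  corner-supported : Present (corner s t) → Present (axis horizontal s) ⊎ Present (axis vertical t)
  corner-supported {s} {t} c∈G with present? (axis horizontal s) | present? (axis vertical t)
  ... | yes h∈G | _       = inj₁ h∈G
  ... | no  _   | yes v∈G = inj₂ v∈G
  ... | no  h∉G | no  v∉G = ⊥-elim (corner-isolated c∈G h∉G v∉G)

  -- A walk in G − u between opposite axial neighbours must cross the perpendicular axis,
  -- and linear convexity pulls the crossing point back to u's neighbour on that axis.
  opposite-bridged : ∀ α → Present (axis α s) → Present (axis α (opposite s)) →
                     ∃[ t ] Present (axis (perp α) t)
  opposite-bridged {s} α a∈G b∈G with present? (axis (perp α) Sign.+) | present? (axis (perp α) Sign.-)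
  ... | yes p∈G | _       = Sign.+ , p∈G
  ... | no  _   | yes m∈G = Sign.- , m∈G
  ... | no  p∉G | no  m∉G = ⊥-elim (¬signed-opposite s b-side)
    where
    absent : ∀ t → ¬ Present (axis (perp α) t)
    absent Sign.+ = p∉G
    absent Sign.- = m∉G

    Side : V → Set
    Side q = Signed s (coord α q)

    closed : StepClosed (G ∖ u) Side
    closed {q = q} (q∈G , u≢q) adj side with coord-step α adj side
    ... | inj₂ side′ = side′
    ... | inj₁ c≡0   = ⊥-elim (absent _ (axis-ray α q∈G c≡0 (signed-sign c⊥≢0)))
      where
      c⊥≢0 : coord (perp α) q ≢ 0ℤ
      c⊥≢0 c⊥≡0 = u≢q (sym (at-centre α c≡0 c⊥≡0))

    walk : Walk (G ∖ u) (u ⊕ offset (axis α s)) (u ⊕ offset (axis α (opposite s)))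
    walk = avoiding-walk two-connected a∈G b∈G (λ eq → opposite-offsets-≢ α s (⊕-cancelˡ u eq))
                         (proj₁ (u~neighbour (axis α s))) (proj₁ (u~neighbour (axis α (opposite s))))

    coord-axis : ∀ t → coord α (u ⊕ offset (axis α t)) ≡ t ◃ 1
    coord-axis t = trans (coord-offset α (axis α t)) (component-axial α (t ◃ 1))

    b-side : Signed s (opposite s ◃ 1)
    b-side = subst (Signed s) (coord-axis (opposite s))
               (walk-preserves closed walk (subst (Signed s) (sym (coord-axis s)) (signed-◃1 s)))

  neighbour-step : ∀ n m → Present m → Adj (offset n) (offset m) →
            Walk Nbhd (u ⊕ offset m) z → Walk Nbhd (u ⊕ offset n) z
  neighbour-step _ m m∈G adj = step (m∈G , u~neighbour m) (Adj-⊕⁺ u adj)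

  ReachesAxis : V → Set
  ReachesAxis x = ∃[ α ] ∃[ s ] (Present (axis α s) × Walk Nbhd x (u ⊕ offset (axis α s)))

  present-reaches-axis : ∀ n → Present n → ReachesAxis (u ⊕ offset n)
  present-reaches-axis (axis α s)   a∈G = α , s , a∈G , here
  present-reaches-axis (corner s t) c∈G with corner-supported c∈G
  ... | inj₁ h∈G = horizontal , s , h∈G ,
    neighbour-step (corner s t) (axis horizontal s) h∈G (proj₁ (corner-adj-axes s t)) here
  ... | inj₂ v∈G = vertical , t , v∈G ,
    neighbour-step (corner s t) (axis vertical t) v∈G (proj₂ (corner-adj-axes s t)) here

  reaches-axis : Nbhd x → ReachesAxis x
  reaches-axis nx =
    let n , n∈G , x≡ = neighbour-view nx in subst ReachesAxis (sym x≡) (present-reaches-axis n n∈G)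

  around : ∀ α s → Present (axis α s) → Present (axis α (opposite s)) →
           Walk Nbhd (u ⊕ offset (axis α s)) (u ⊕ offset (axis α (opposite s)))
  around α s a∈G b∈G with opposite-bridged α a∈G b∈G
  ... | t , m∈G =
    neighbour-step (axis α s) (axis (perp α) t) m∈G (axis-adj-perp α s t)
      (neighbour-step (axis (perp α) t) (axis α (opposite s)) b∈G
        (Adj-sym (axis-adj-perp α (opposite s) t)) here)

  along-axis : ∀ α s t → Present (axis α s) → Present (axis α t) →
               Walk Nbhd (u ⊕ offset (axis α s)) (u ⊕ offset (axis α t))
  along-axis α Sign.+ Sign.+ _ _ = here
  along-axis α Sign.- Sign.- _ _ = here
  along-axis α Sign.+ Sign.- = around α Sign.+
  along-axis α Sign.- Sign.+ = around α Sign.-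

  between-axes : ∀ α s β t → Present (axis α s) → Present (axis β t) →
                 Walk Nbhd (u ⊕ offset (axis α s)) (u ⊕ offset (axis β t))
  between-axes horizontal s horizontal t = along-axis horizontal s t
  between-axes vertical   s vertical   t = along-axis vertical s t
  between-axes horizontal s vertical t _ b∈G =
    neighbour-step (axis horizontal s) (axis vertical t) b∈G (axis-adj-perp horizontal s t) here
  between-axes vertical s horizontal t _ b∈G =
    neighbour-step (axis vertical s) (axis horizontal t) b∈G (axis-adj-perp vertical s t) here

  connected : InducedConnected Nbhd
  connected x y nx ny =
    let α , s , a∈G , x→a = reaches-axis nx
        β , t , b∈G , y→b = reaches-axis ny
    in x→a ++ʷ (between-axes α s β t a∈G b∈G ++ʷ reverseʷ ny y→b)

theorem1 : (G : SupergridGraph) → TwoConnected G → LinearConvex G → LocallyConnected G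
theorem1 G two-connected convex u u∈G = Neighbourhood.connected G two-connected convex u u∈G
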